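{- (i) For a positive integer $k$, let $b=2k+1$, $N=\frac{b^4-1}{2}$ and $\mathbf{v}=(1,b,b^2,b^3)$. Then $$\lim_{k\to\infty}\frac{\lambda^{\ast}(\Pi^4_{N,\mathbf{v}})}{N^{3/4}}=2^{1/4}.$$ (ii) For a positive integer $k$, let $b=2k+1$, $N=\frac{b^5-1}{2}$ and $\mathbf{v}=(1,b,b^2,b^3,b^4)$. Then $$\lim_{k\to\infty}\frac{\lambda^{\ast}(\Pi^5_{N,\mathbf{v}})}{N^{4/5}}=2^{3/10}.$$ In both parts $N$ and $\mathbf{v}$ depend on $k$ as indicated.
   Context: For $d\in\{4,5\}$ and integers $N,a_1,\dots,a_d$ with $0<a_1<\dots<a_d<N$ and $\gcd(N,a_1)=1$, write $\mathbf{v}=(a_1,\dots,a_d)$ and define $$\Pi^d_{N,\mathbf{v}}=\{(na_1 \bmod N,\ \dots,\ na_d \bmod N): 0\le n<N\}\subset[0,N-1]^d,$$ where $x \bmod N$ denotes the least nonnegative residue of $x$ modulo $N$, and $$\lambda^{\ast}(\Pi^d_{N,\mathbf{v}})=\min_{\mathbf{x}\neq\mathbf{y},\ \mathbf{x},\mathbf{y}\in\Pi^d_{N,\mathbf{v}}}\|\mathbf{x}-\mathbf{y}\|$$ (Euclidean norm). -}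

module Defs where

open import Data.Nat using (ℕ; zero; suc; _+_; _*_; _∸_; _^_; _⊓_; ∣_-_∣)
open import Data.Nat.DivMod using (_%_; _/_)
open import Data.Nat.Properties using (_≟_)
open import Data.List using (List; []; _∷_; upTo; concatMap)
open import Data.Vec using (Vec; []; _∷_; map; foldr)
open import Data.Vec.Properties using (≡-dec)
open import Data.Integer using (+_)
open import Data.Rational as ℚ using (ℚ)
open import Relation.Nullary using (yes; no)

-- The point (n a_1 mod N, ..., n a_d mod N) of Π^d_{N,v}.
-- For N = 0 we return the zero vector (never used: N ≥ 2 in the theorem).
point : ∀ {d} → ℕ → Vec ℕ d → ℕ → Vec ℕ d
point zero    v n = map (λ _ → 0) v
point (suc M) v n = map (λ a → (n * a) % suc M) v

sqDist : ∀ {d} → Vec ℕ d → Vec ℕ d → ℕ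
sqDist []       []       = 0
sqDist (x ∷ xs) (y ∷ ys) = ∣ x - y ∣ * ∣ x - y ∣ + sqDist xs ys

-- Minimum of a list of naturals (0 for the empty list; irrelevant here).
minimum : List ℕ → ℕ
minimum []       = 0
minimum (x ∷ []) = x
minimum (x ∷ y ∷ xs) = x ⊓ minimum (y ∷ xs)

distinctSqDists : ∀ {d} → ℕ → Vec ℕ d → List ℕ
distinctSqDists N v =
  concatMap (λ n → concatMap (λ m → f (point N v n) (point N v m)) (upTo N)) (upTo N)
  where
  f : _ → _ → List ℕ
  f x y with ≡-dec _≟_ x y
  ... | yes _ = []
  ... | no  _ = sqDist x y ∷ []

lambdaSq : ∀ {d} → ℕ → Vec ℕ d → ℕ
lambdaSq N v = minimum (distinctSqDists N v)

ℕ→ℚ : ℕ → ℚ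
ℕ→ℚ n = + n ℚ./ 1

bOf : ℕ → ℕ
bOf k = 2 * k + 1

N4 : ℕ → ℕ
N4 k = (bOf k ^ 4 ∸ 1) / 2

v4 : ℕ → Vec ℕ 4
v4 k = 1 ∷ bOf k ∷ bOf k ^ 2 ∷ bOf k ^ 3 ∷ []

N5 : ℕ → ℕ
N5 k = (bOf k ^ 5 ∸ 1) / 2

v5 : ℕ → Vec ℕ 5
v5 k = 1 ∷ bOf k ∷ bOf k ^ 2 ∷ bOf k ^ 3 ∷ bOf k ^ 4 ∷ []

{-# OPTIONS --safe #-}

-- Coordinatewise differences (d₀ , … , d_{d-1}) of two points satisfy b dᵢ = dᵢ₊₁ + N qᵢ with indices
-- mod d, as bᵈ = 2N + 1 ≡ 1 (mod N). Solving this linear system gives 2 d₀ = Σ b^(d-1-i) qᵢ, so for odd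
-- b the number Σ qᵢ² is even; it is positive when d₀ ≠ 0. Hence
--   2N² ≤ N² Σ qᵢ² = Σ (b dᵢ - dᵢ₊₁)² ≤ (b + 1)² Σ dᵢ²,
-- that is, λ*² ≥ 2N² / (b + 1)². The point with index (b^(d-1) + 1) / 2 shows that
-- λ*² ≤ (b + 1)^(2d-2) / 2. Since 2N ~ (b + 1)ᵈ, both bounds are asymptotic to (b + 1)^(2d-2) / 2.

module Submission where

open import Defs
open import Data.Nat using (ℕ; zero; suc; s≤s; z≤n; _≤_; _^_)
open import Data.Product using (_×_; ∃; ∃₂; _,_; proj₁; proj₂)
open import Data.Fin using (toℕ)
import Data.Integer as ℤ
import Data.Integer.Properties as ℤₚ
open import Algebra.Properties.AbelianGroup ℤₚ.+-0-abelianGroup using (∙-cancelˡ)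
import Data.Integer.Tactic.RingSolver as ℤ-Solver
open import Data.List using (_∷_; []; upTo)
open import Data.List.Membership.Propositional using (_∈_; find; lose)
open import Data.List.Membership.Propositional.Properties
  using (∈-concatMap⁺; ∈-concatMap⁻; ∈-upTo⁺; ∈-upTo⁻)
open import Data.List.Relation.Unary.Any using (here; there)
import Data.Nat as ℕ
open import Data.Nat.DivMod
  using (_%_; _/_; m≡m%n+[m/n]*n; m<n⇒m%n≡m; [m+kn]%n≡m%n; m%n≤m; m*n/n≡m)
import Data.Nat.Properties as ℕₚ
import Data.Nat.Tactic.RingSolver as ℕ-Solver
import Data.Rational as ℚ
import Data.Rational.Properties as ℚₚ
import Data.Rational.Unnormalised as ℚᵘ
import Data.Rational.Unnormalised.Properties as ℚᵘₚ
open import Data.Sum using (inj₁; inj₂)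
open import Data.Vec as Vec using (Vec; _∷_; []; tabulate)
open import Data.Vec.Properties using (≡-dec)
open import Function using (_∘_)
open import Relation.Binary.PropositionalEquality
import Relation.Binary.Reasoning.Setoid as SetoidReasoning
open import Relation.Nullary using (yes; no; contradiction)

-- The factor (b + 1)² arises by summing (b x - y)² ≤ (b + 1)(b x² + y²) once round the cycle, where
-- Σ dᵢ₊₁² = Σ dᵢ². The index (b^(d-1) + 1) / 2 is what 2 d₀ = Σ b^(d-1-i) qᵢ returns for q = (1, 0,
-- ..., 0, 1), a choice with Σ qᵢ² = 2, the least value that parity admits. The first and last
-- coordinates of its point are both close to b^(d-1) / 2 and dominate the others, which explains
-- the value (b + 1)^(2d-2) / 2. The limits 2^(1/4) and 2^(3/10) are irrational, so convergence is
-- expressed for λ*^(2p) / N^q with limit 2^s, cleared of denominators. The estimates behind it have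
-- relative error O(1/b) and stay in ℕ, each subtracted term being moved to the other side.
-- Sequences are indexed by all of ℕ, so that inductions can shift them by `suc`; the cycle enters
-- only through `d n ≡ d 0`.

sumSq : (ℕ → ℤ.ℤ) → ℕ → ℕ
sumSq f zero    = 0
sumSq f (suc n) = ℤ.∣ f 0 ∣ ℕ.* ℤ.∣ f 0 ∣ ℕ.+ sumSq (f ∘ suc) n

-- Periodic integer sequences: parity and the lower bound for the sum of squares.

module CyclicSequences where
  open ℤ using (ℤ; +_; -[1+_]; ∣_∣; _+_; _*_; _-_)

  +∣i∣*∣i∣≡i*i : ∀ i → + (∣ i ∣ ℕ.* ∣ i ∣) ≡ i * i
  +∣i∣*∣i∣≡i*i (+ n)    = ℤₚ.pos-* n n
  +∣i∣*∣i∣≡i*i -[1+ n ] = refl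

  n*n≡n+2r : ∀ n → ∃ λ r → n ℕ.* n ≡ n ℕ.+ 2 ℕ.* r
  n*n≡n+2r zero    = 0 , refl
  n*n≡n+2r (suc n) with r , eq ← n*n≡n+2r n = r ℕ.+ n , (begin
    suc n ℕ.* suc n                             ≡⟨ expand n ⟩
    n ℕ.* n ℕ.+ (2 ℕ.* n ℕ.+ 1)                 ≡⟨ cong (ℕ._+ (2 ℕ.* n ℕ.+ 1)) eq ⟩
    n ℕ.+ 2 ℕ.* r ℕ.+ (2 ℕ.* n ℕ.+ 1)           ≡⟨ collect n r ⟩
    suc n ℕ.+ 2 ℕ.* (r ℕ.+ n)                   ∎)
    where
    open ≡-Reasoning
    expand : ∀ x → suc x ℕ.* suc x ≡ x ℕ.* x ℕ.+ (2 ℕ.* x ℕ.+ 1)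
    expand = ℕ-Solver.solve-∀
    collect : ∀ x r → x ℕ.+ 2 ℕ.* r ℕ.+ (2 ℕ.* x ℕ.+ 1) ≡ suc x ℕ.+ 2 ℕ.* (r ℕ.+ x)
    collect = ℕ-Solver.solve-∀

  i*i≡i+2r : ∀ i → ∃ λ r → i * i ≡ i + + 2 * r
  i*i≡i+2r (+ n) with r , eq ← n*n≡n+2r n = + r ,
    trans (sym (ℤₚ.pos-* n n)) (trans (cong +_ eq) (cong (λ x → + n + x) (ℤₚ.pos-* 2 r)))
  i*i≡i+2r -[1+ n ] with r , eq ← i*i≡i+2r (+ suc n) =
    r + + suc n , trans eq (flip-sign (+ suc n) r)
    where
    flip-sign : ∀ x r → x + + 2 * r ≡ ℤ.- x + + 2 * (r + x)
    flip-sign = ℤ-Solver.solve-∀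

  odd-^ : ∀ {b} → (∃ λ k → b ≡ suc (2 ℕ.* k)) → ∀ n → ∃ λ h → b ^ n ≡ suc (2 ℕ.* h)
  odd-^ b-odd       zero    = 0 , refl
  odd-^ (k , refl) (suc n) with h , eq ← odd-^ (k , refl) n =
    h ℕ.+ k ℕ.+ 2 ℕ.* (k ℕ.* h) ,
    trans (cong (suc (2 ℕ.* k) ℕ.*_) eq) (expand k h)
    where
    expand : ∀ k h → suc (2 ℕ.* k) ℕ.* suc (2 ℕ.* h) ≡ suc (2 ℕ.* (h ℕ.+ k ℕ.+ 2 ℕ.* (k ℕ.* h)))
    expand = ℕ-Solver.solve-∀

  -- The polynomial Σ b^(n-1-i) qᵢ, with `q 0` as leading coefficient.
  horner : ℕ → (ℕ → ℤ) → ℕ → ℤ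
  horner b q zero    = + 0
  horner b q (suc n) = + (b ^ n) * q 0 + horner b (q ∘ suc) n

  -- Powers of an odd `b` are odd and an integer has the parity of its square, so modulo 2 each term
  -- of `horner` is the square of its coefficient.
  horner≡sumSq+2r : ∀ {b} → (∃ λ k → b ≡ suc (2 ℕ.* k)) → ∀ q n →
                    ∃ λ r → horner b q n ≡ + sumSq q n + + 2 * r
  horner≡sumSq+2r b-odd q zero = + 0 , refl
  horner≡sumSq+2r {b} b-odd q (suc n)
    with t , ih ← horner≡sumSq+2r b-odd (q ∘ suc) n
       | h , bⁿ ← odd-^ b-odd n
       | r , q² ← i*i≡i+2r (q 0) = + h * q 0 + t - r , (begin
    + (b ^ n) * q 0 + horner b (q ∘ suc) n
      ≡⟨ cong₂ (λ x y → + x * q 0 + y) bⁿ ih ⟩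
    + suc (2 ℕ.* h) * q 0 + (s + + 2 * t)
      ≡⟨ cong (λ x → (+ 1 + x) * q 0 + (s + + 2 * t)) (ℤₚ.pos-* 2 h) ⟩
    (+ 1 + + 2 * + h) * q 0 + (s + + 2 * t)
      ≡⟨ regroup (+ h) (q 0) r s t ⟩
    q 0 + + 2 * r + s + + 2 * (+ h * q 0 + t - r)
      ≡⟨ cong (λ x → x + s + + 2 * (+ h * q 0 + t - r))
              (sym (trans (+∣i∣*∣i∣≡i*i (q 0)) q²)) ⟩
    + sumSq q (suc n) + + 2 * (+ h * q 0 + t - r) ∎)
    where
    open ≡-Reasoning
    s = + sumSq (q ∘ suc) n
    regroup : ∀ h x r s t → (+ 1 + + 2 * h) * x + (s + + 2 * t) ≡
                            x + + 2 * r + s + + 2 * (h * x + t - r)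
    regroup = ℤ-Solver.solve-∀

  sumSq≡0⇒horner≡0 : ∀ b q n → sumSq q n ≡ 0 → horner b q n ≡ + 0
  sumSq≡0⇒horner≡0 b q zero    _  = refl
  sumSq≡0⇒horner≡0 b q (suc n) eq = begin
    + (b ^ n) * q 0 + horner b (q ∘ suc) n ≡⟨ cong₂ (λ x y → + (b ^ n) * x + y) q₀≡0 tail≡0 ⟩
    + (b ^ n) * + 0 + + 0                  ≡⟨ cong (_+ + 0) (ℤₚ.*-zeroʳ (+ (b ^ n))) ⟩
    + 0                                    ∎
    where
    open ≡-Reasoning
    tail≡0 = sumSq≡0⇒horner≡0 b (q ∘ suc) n (ℕₚ.m+n≡0⇒n≡0 (∣ q 0 ∣ ℕ.* ∣ q 0 ∣) eq)
    q₀≡0 : q 0 ≡ + 0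
    q₀≡0 with ℕₚ.m*n≡0⇒m≡0∨n≡0 ∣ q 0 ∣ (ℕₚ.m+n≡0⇒m≡0 (∣ q 0 ∣ ℕ.* ∣ q 0 ∣) eq)
    ... | inj₁ z = ℤₚ.∣i∣≡0⇒i≡0 z
    ... | inj₂ z = ℤₚ.∣i∣≡0⇒i≡0 z

  -- Each multiplication by `b` trades `d i` for `d (suc i)` at the price of a multiple of `N`;
  -- `horner` collects these multiples, each carrying the powers of `b` still to come.
  horner-telescope : ∀ b N d q → (∀ i → + b * d i ≡ d (suc i) + + N * q i) → ∀ n →
                     + (b ^ n) * d 0 ≡ d n + + N * horner b q n
  horner-telescope b N d q step zero =
    trans (ℤₚ.*-identityˡ (d 0)) (sym (trans (cong (λ x → d 0 + x) (ℤₚ.*-zeroʳ (+ N))) (ℤₚ.+-identityʳ (d 0))))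
  horner-telescope b N d q step (suc n) = begin
    + (b ℕ.* b ^ n) * d 0          ≡⟨ cong (_* d 0) (ℤₚ.pos-* b (b ^ n)) ⟩
    + b * + (b ^ n) * d 0          ≡⟨ swap (+ b) (+ (b ^ n)) (d 0) ⟩
    + (b ^ n) * (+ b * d 0)        ≡⟨ cong (+ (b ^ n) *_) (step 0) ⟩
    + (b ^ n) * (d 1 + + N * q 0)  ≡⟨ distrib (+ (b ^ n)) (d 1) (+ N) (q 0) ⟩
    + (b ^ n) * d 1 + + N * (+ (b ^ n) * q 0)
      ≡⟨ cong (_+ + N * (+ (b ^ n) * q 0)) (horner-telescope b N (d ∘ suc) (q ∘ suc) (step ∘ suc) n) ⟩
    d (suc n) + + N * horner b (q ∘ suc) n + + N * (+ (b ^ n) * q 0)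
      ≡⟨ collect (d (suc n)) (+ N) (horner b (q ∘ suc) n) (+ (b ^ n) * q 0) ⟩
    d (suc n) + + N * horner b q (suc n) ∎
    where
    open ≡-Reasoning
    swap : ∀ x y z → x * y * z ≡ y * (x * z)
    swap = ℤ-Solver.solve-∀
    distrib : ∀ x y z w → x * (y + z * w) ≡ x * y + z * (x * w)
    distrib = ℤ-Solver.solve-∀
    collect : ∀ x y z w → x + y * z + y * w ≡ x + y * (w + z)
    collect = ℤ-Solver.solve-∀

  -- Cauchy-Schwarz with weights b and 1. Its defect is explicit: (b d - d′)² + b (d + d′)² = (b +
  -- 1)(b d² + d′²).
  square-step : ∀ b N d d′ q → + b * d ≡ d′ + + N * q →
    N ℕ.* N ℕ.* (∣ q ∣ ℕ.* ∣ q ∣) ℕ.≤ suc b ℕ.* (b ℕ.* (∣ d ∣ ℕ.* ∣ d ∣) ℕ.+ ∣ d′ ∣ ℕ.* ∣ d′ ∣)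
  square-step b N d d′ q eq = ℕₚ.m+n≤o⇒m≤o _ (ℕₚ.≤-reflexive (ℤₚ.+-injective (begin
    + (N ℕ.* N ℕ.* sq q ℕ.+ b ℕ.* sq (d + d′))
      ≡⟨ cong₂ _+_ (trans (ℤₚ.pos-* (N ℕ.* N) (sq q)) (cong₂ _*_ (ℤₚ.pos-* N N) (+∣i∣*∣i∣≡i*i q)))
                   (trans (ℤₚ.pos-* b (sq (d + d′))) (cong (+ b *_) (+∣i∣*∣i∣≡i*i (d + d′)))) ⟩
    + N * + N * (q * q) + + b * ((d + d′) * (d + d′))
      ≡⟨ complete (+ N) q (+ b) d d′ ⟩
    (d′ + + N * q - d′) * (d′ + + N * q - d′) + + b * ((d + d′) * (d + d′))
      ≡⟨ cong (λ x → (x - d′) * (x - d′) + + b * ((d + d′) * (d + d′))) (sym eq) ⟩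
    (+ b * d - d′) * (+ b * d - d′) + + b * ((d + d′) * (d + d′))
      ≡⟨ complete-square (+ b) d d′ ⟩
    (+ 1 + + b) * (+ b * (d * d) + d′ * d′)
      ≡⟨ cong (+ suc b *_) (sym (cong₂ _+_
           (trans (ℤₚ.pos-* b (sq d)) (cong (+ b *_) (+∣i∣*∣i∣≡i*i d))) (+∣i∣*∣i∣≡i*i d′))) ⟩
    + suc b * + (b ℕ.* sq d ℕ.+ sq d′)
      ≡⟨ sym (ℤₚ.pos-* (suc b) _) ⟩
    + (suc b ℕ.* (b ℕ.* sq d ℕ.+ sq d′)) ∎)))
    where
    open ≡-Reasoning
    sq : ℤ → ℕ
    sq i = ∣ i ∣ ℕ.* ∣ i ∣
    complete : ∀ N q b d e → N * N * (q * q) + b * ((d + e) * (d + e)) ≡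
                             (e + N * q - e) * (e + N * q - e) + b * ((d + e) * (d + e))
    complete = ℤ-Solver.solve-∀
    complete-square : ∀ b d e → (b * d - e) * (b * d - e) + b * ((d + e) * (d + e)) ≡
                            (+ 1 + b) * (b * (d * d) + e * e)
    complete-square = ℤ-Solver.solve-∀

  sumSq-step : ∀ b N d q → (∀ i → + b * d i ≡ d (suc i) + + N * q i) → ∀ n →
    N ℕ.* N ℕ.* sumSq q n ℕ.≤ suc b ℕ.* (b ℕ.* sumSq d n ℕ.+ sumSq (d ∘ suc) n)
  sumSq-step b N d q step zero    = ℕₚ.≤-trans (ℕₚ.≤-reflexive (ℕₚ.*-zeroʳ (N ℕ.* N))) z≤n
  sumSq-step b N d q step (suc n) = begin
    N ℕ.* N ℕ.* (∣ q 0 ∣ ℕ.* ∣ q 0 ∣ ℕ.+ sumSq (q ∘ suc) n)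
      ≡⟨ ℕₚ.*-distribˡ-+ (N ℕ.* N) (∣ q 0 ∣ ℕ.* ∣ q 0 ∣) _ ⟩
    N ℕ.* N ℕ.* (∣ q 0 ∣ ℕ.* ∣ q 0 ∣) ℕ.+ N ℕ.* N ℕ.* sumSq (q ∘ suc) n
      ≤⟨ ℕₚ.+-mono-≤ (square-step b N (d 0) (d 1) (q 0) (step 0))
                     (sumSq-step b N (d ∘ suc) (q ∘ suc) (step ∘ suc) n) ⟩
    suc b ℕ.* (b ℕ.* x ℕ.+ y) ℕ.+ suc b ℕ.* (b ℕ.* s ℕ.+ t)
      ≡⟨ regroup b x y s t ⟩
    suc b ℕ.* (b ℕ.* (x ℕ.+ s) ℕ.+ (y ℕ.+ t)) ∎
    where
    open ℕₚ.≤-Reasoning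
    x = ∣ d 0 ∣ ℕ.* ∣ d 0 ∣
    y = ∣ d 1 ∣ ℕ.* ∣ d 1 ∣
    s = sumSq (d ∘ suc) n
    t = sumSq (d ∘ suc ∘ suc) n
    regroup : ∀ b x y s t → suc b ℕ.* (b ℕ.* x ℕ.+ y) ℕ.+ suc b ℕ.* (b ℕ.* s ℕ.+ t) ≡
                            suc b ℕ.* (b ℕ.* (x ℕ.+ s) ℕ.+ (y ℕ.+ t))
    regroup = ℕ-Solver.solve-∀

  sumSq-snoc : ∀ f n → sumSq f (suc n) ≡ sumSq f n ℕ.+ ∣ f n ∣ ℕ.* ∣ f n ∣
  sumSq-snoc f zero    = ℕₚ.+-identityʳ _
  sumSq-snoc f (suc n) = trans (cong (∣ f 0 ∣ ℕ.* ∣ f 0 ∣ ℕ.+_) (sumSq-snoc (f ∘ suc) n))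
                               (sym (ℕₚ.+-assoc (∣ f 0 ∣ ℕ.* ∣ f 0 ∣) _ _))

  -- Of `suc n` consecutive squares, dropping the first or the last leaves the same sum, because
  -- these two are equal.
  sumSq-rotate : ∀ f n → f n ≡ f 0 → sumSq (f ∘ suc) n ≡ sumSq f n
  sumSq-rotate f n fₙ≡f₀ = ℕₚ.+-cancelˡ-≡ (∣ f 0 ∣ ℕ.* ∣ f 0 ∣) _ _
    (trans (sumSq-snoc f n) (trans (cong (λ x → sumSq f n ℕ.+ ∣ x ∣ ℕ.* ∣ x ∣) fₙ≡f₀)
                                   (ℕₚ.+-comm (sumSq f n) _)))

  sumSq-lower-bound : ∀ b N d q n → (∃ λ k → b ≡ suc (2 ℕ.* k)) → b ^ n ≡ suc (2 ℕ.* N) →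
    .{{_ : ℕ.NonZero N}} → (∀ i → + b * d i ≡ d (suc i) + + N * q i) → d n ≡ d 0 → d 0 ≢ + 0 →
    2 ℕ.* (N ℕ.* N) ℕ.≤ suc b ℕ.* suc b ℕ.* sumSq d n
  sumSq-lower-bound b N d q n b-odd bⁿ step dₙ≡d₀ d₀≢0 = begin
    2 ℕ.* (N ℕ.* N)                                      ≡⟨ ℕₚ.*-comm 2 (N ℕ.* N) ⟩
    N ℕ.* N ℕ.* 2                                        ≤⟨ ℕₚ.*-monoʳ-≤ (N ℕ.* N) (2≤ (sumSq q n) refl) ⟩
    N ℕ.* N ℕ.* sumSq q n                                ≤⟨ sumSq-step b N d q step n ⟩
    suc b ℕ.* (b ℕ.* sumSq d n ℕ.+ sumSq (d ∘ suc) n)    ≡⟨ cong (λ x → suc b ℕ.* (b ℕ.* sumSq d n ℕ.+ x)) (sumSq-rotate d n dₙ≡d₀) ⟩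
    suc b ℕ.* (b ℕ.* sumSq d n ℕ.+ sumSq d n)            ≡⟨ regroup b (sumSq d n) ⟩
    suc b ℕ.* suc b ℕ.* sumSq d n                        ∎
    where
    open ℕₚ.≤-Reasoning
    regroup : ∀ b s → suc b ℕ.* (b ℕ.* s ℕ.+ s) ≡ suc b ℕ.* suc b ℕ.* s
    regroup = ℕ-Solver.solve-∀
    -- Here b^n d₀ = d₀ + N (2 d₀), so after telescoping the periodicity cancels d₀, and then N
    -- cancels.
    2d₀≡horner : + 2 * d 0 ≡ horner b q n
    2d₀≡horner = ℤₚ.*-cancelˡ-≡ (+ N) _ _ (∙-cancelˡ (d 0) _ _ (trans
      (trans (expand (+ N) (d 0))
        (cong (_* d 0) (sym (trans (cong +_ bⁿ) (cong (λ x → + 1 + x) (ℤₚ.pos-* 2 N))))))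
      (trans (horner-telescope b N d q step n) (cong (_+ + N * horner b q n) dₙ≡d₀))))
      where
      expand : ∀ N x → x + N * (+ 2 * x) ≡ (+ 1 + + 2 * N) * x
      expand = ℤ-Solver.solve-∀
    -- Σ qᵢ² has the parity of 2 d₀, and q = 0 forces d₀ = 0.
    2≤ : ∀ s → sumSq q n ≡ s → 2 ℕ.≤ s
    2≤ zero          eq = contradiction
      (ℤₚ.*-cancelˡ-≡ (+ 2) (d 0) (+ 0) (trans 2d₀≡horner (sumSq≡0⇒horner≡0 b q n eq))) d₀≢0
    2≤ (suc zero)    eq with r , h ← horner≡sumSq+2r b-odd q n = contradiction
      (trans (sym (ℤₚ.abs-* (+ 2) (d 0 - r))) (cong ∣_∣ odd)) (even≢1 ∣ d 0 - r ∣)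
      where
      distrib : ∀ x r → + 2 * (x - r) ≡ + 2 * x - + 2 * r
      distrib = ℤ-Solver.solve-∀
      cancel : ∀ r → (+ 1 + + 2 * r) - + 2 * r ≡ + 1
      cancel = ℤ-Solver.solve-∀
      odd : + 2 * (d 0 - r) ≡ + 1
      odd = trans (distrib (d 0) r) (trans (cong (_- + 2 * r)
        (trans 2d₀≡horner (trans h (cong (λ s → + s + + 2 * r) eq)))) (cancel r))
      even≢1 : ∀ m → 2 ℕ.* m ≢ 1
      even≢1 (suc m) e with () ← ℕₚ.m+n≡0⇒n≡0 m (ℕₚ.suc-injective e)
    2≤ (suc (suc s)) eq = s≤s (s≤s z≤n)

-- The minimum over pairs of points, and the coordinates as a periodic sequence.

module PointSets where
  open import Data.Nat using (_+_; _*_; _<_; ∣_-_∣)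

  minimum-≤ : ∀ {x} xs → x ∈ xs → minimum xs ≤ x
  minimum-≤ (x ∷ [])     (here refl) = ℕₚ.≤-refl
  minimum-≤ (x ∷ y ∷ xs) (here refl) = ℕₚ.m⊓n≤m x _
  minimum-≤ (x ∷ y ∷ xs) (there z∈)  = ℕₚ.≤-trans (ℕₚ.m⊓n≤n x _) (minimum-≤ (y ∷ xs) z∈)

  minimum-∈ : ∀ x xs → minimum (x ∷ xs) ∈ x ∷ xs
  minimum-∈ x []       = here refl
  minimum-∈ x (y ∷ xs) with ℕₚ.⊓-sel x (minimum (y ∷ xs))
  ... | inj₁ eq = here eq
  ... | inj₂ eq = there (subst (_∈ y ∷ xs) (sym eq) (minimum-∈ y xs))

  inhabited⇒minimum-∈ : ∀ {x xs} → x ∈ xs → minimum xs ∈ xs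
  inhabited⇒minimum-∈ {xs = x ∷ xs} _ = minimum-∈ x xs

  -- The underscore is the list that a single pair (n , m) contributes; its
  -- name is local to distinctSqDists.
  ∈-contribution⁺ : ∀ {d} N (v : Vec ℕ d) {n m s} → n < N → m < N → s ∈ _ → s ∈ distinctSqDists N v
  ∈-contribution⁺ N v n<N m<N s∈ =
    ∈-concatMap⁺ _ {xs = upTo N} (lose (∈-upTo⁺ n<N)
      (∈-concatMap⁺ _ {xs = upTo N} (lose (∈-upTo⁺ m<N) s∈)))

  ∈-distinctSqDists⁺ : ∀ {d} N (v : Vec ℕ d) {n m} → n < N → m < N → point N v n ≢ point N v m →
                       sqDist (point N v n) (point N v m) ∈ distinctSqDists N v
  ∈-distinctSqDists⁺ N v {n} {m} n<N m<N x≢y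
    -- The lifting map is abstracted together with the decision, so that the list hidden in its type
    -- reduces in each branch.
    with ≡-dec ℕₚ._≟_ (point N v n) (point N v m) |
         ∈-contribution⁺ N v {s = sqDist (point N v n) (point N v m)} n<N m<N
  ... | yes x≡y | _    = contradiction x≡y x≢y
  ... | no  _   | lift = lift (here refl)

  ∈-distinctSqDists⁻ : ∀ {d} N (v : Vec ℕ d) {s} → s ∈ distinctSqDists N v →
    ∃₂ λ n m → n < N × m < N × point N v n ≢ point N v m × s ≡ sqDist (point N v n) (point N v m)
  ∈-distinctSqDists⁻ N v s∈
    with n , n∈ , s∈ₙ ← find (∈-concatMap⁻ _ {xs = upTo N} s∈)
    with m , m∈ , s∈ₙₘ ← find (∈-concatMap⁻ _ {xs = upTo N} s∈ₙ)
    with ≡-dec ℕₚ._≟_ (point N v n) (point N v m) | s∈ₙₘ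
  ... | no x≢y | here s≡ = n , m , ∈-upTo⁻ n∈ , ∈-upTo⁻ m∈ , x≢y , s≡

  lambdaSq-≤ : ∀ {d} N (v : Vec ℕ d) {n m} → n < N → m < N → point N v n ≢ point N v m →
               lambdaSq N v ≤ sqDist (point N v n) (point N v m)
  lambdaSq-≤ N v n<N m<N x≢y = minimum-≤ (distinctSqDists N v) (∈-distinctSqDists⁺ N v n<N m<N x≢y)

  -- The minimum is attained once the list is inhabited; the pair `n`, `m` serves to rule out the
  -- empty list, whose minimum is 0 by convention.
  lambdaSq-elim : ∀ {d} N (v : Vec ℕ d) (P : ℕ → Set) →
    (∀ i j → i < N → j < N → point N v i ≢ point N v j → P (sqDist (point N v i) (point N v j))) →
    ∀ {n m} → n < N → m < N → point N v n ≢ point N v m → P (lambdaSq N v)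
  lambdaSq-elim N v P p n<N m<N x≢y
    with i , j , i<N , j<N , xᵢ≢xⱼ , eq ←
      ∈-distinctSqDists⁻ N v (inhabited⇒minimum-∈ (∈-distinctSqDists⁺ N v n<N m<N x≢y)) =
    subst P (sym eq) (p i j i<N j<N xᵢ≢xⱼ)

  powers : ℕ → ∀ d → Vec ℕ d
  powers b d = tabulate (λ i → b ^ toℕ i)

  ∣+m-+n∣≡∣m-n∣ : ∀ m n → ℤ.∣ ℤ.+ m ℤ.- ℤ.+ n ∣ ≡ ∣ m - n ∣
  ∣+m-+n∣≡∣m-n∣ m n with ℕₚ.≤-total m n
  ... | inj₁ m≤n = trans (cong ℤ.∣_∣ (ℤₚ.[+m]-[+n]≡m⊖n m n))
                         (trans (ℤₚ.∣⊖∣-≤ m≤n) (sym (ℕₚ.m≤n⇒∣m-n∣≡n∸m m≤n)))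
  ... | inj₂ n≤m = trans (cong ℤ.∣_∣ (trans (ℤₚ.[+m]-[+n]≡m⊖n m n) (ℤₚ.⊖-≥ n≤m)))
                         (sym (ℕₚ.m≤n⇒∣n-m∣≡n∸m n≤m))

  -- The generators form an arbitrary sequence `a`, since the induction replaces `a` by `a ∘ suc`,
  -- which leaves the form b^i.
  sqDist-map-tabulate : ∀ (f g a : ℕ → ℕ) d →
    sqDist (Vec.map f (tabulate {n = d} (a ∘ toℕ))) (Vec.map g (tabulate (a ∘ toℕ))) ≡
    sumSq (λ i → ℤ.+ f (a i) ℤ.- ℤ.+ g (a i)) d
  sqDist-map-tabulate f g a zero    = refl
  sqDist-map-tabulate f g a (suc d) =
    cong₂ _+_ (cong (λ x → x * x) (sym (∣+m-+n∣≡∣m-n∣ (f (a 0)) (g (a 0)))))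
              (sqDist-map-tabulate f g (a ∘ suc) d)

  module _ (b M d : ℕ) (b-odd : ∃ λ k → b ≡ suc (2 * k)) (b^d : b ^ d ≡ suc (2 * suc M)) where
    private
      N = suc M

    coord : ℕ → ℕ → ℕ
    coord n i = (n * b ^ i) % N

    -- The integer qᵢ of a single point: multiply n b^i = xᵢ + Kᵢ N by b, compare with n b^(i+1) =
    -- xᵢ₊₁ + Kᵢ₊₁ N, and read off b xᵢ = xᵢ₊₁ + N (Kᵢ₊₁ - b Kᵢ).
    carry : ℕ → ℕ → ℤ.ℤ
    carry n i = ℤ.+ ((n * b ^ suc i) / N) ℤ.- ℤ.+ b ℤ.* ℤ.+ ((n * b ^ i) / N)

    coord-step : ∀ n i → ℤ.+ b ℤ.* ℤ.+ coord n i ≡ ℤ.+ coord n (suc i) ℤ.+ ℤ.+ N ℤ.* carry n i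
    coord-step n i = begin
      B ℤ.* x                            ≡⟨ complete B x L K ⟩
      B ℤ.* (x ℤ.+ K ℤ.* L) ℤ.- L ℤ.* (B ℤ.* K)
        ≡⟨ cong (λ z → B ℤ.* z ℤ.- L ℤ.* (B ℤ.* K)) (sym (division i)) ⟩
      B ℤ.* ℤ.+ (n * b ^ i) ℤ.- L ℤ.* (B ℤ.* K)
        ≡⟨ cong (ℤ._- L ℤ.* (B ℤ.* K)) (trans (sym (ℤₚ.pos-* b (n * b ^ i))) (cong ℤ.+_ (shift b n (b ^ i)))) ⟩
      ℤ.+ (n * b ^ suc i) ℤ.- L ℤ.* (B ℤ.* K)
        ≡⟨ cong (ℤ._- L ℤ.* (B ℤ.* K)) (division (suc i)) ⟩
      x′ ℤ.+ K′ ℤ.* L ℤ.- L ℤ.* (B ℤ.* K) ≡⟨ collect x′ K′ L (B ℤ.* K) ⟩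
      x′ ℤ.+ L ℤ.* (K′ ℤ.- B ℤ.* K)       ∎
      where
      open ≡-Reasoning
      B = ℤ.+ b
      L = ℤ.+ N
      x = ℤ.+ coord n i
      x′ = ℤ.+ coord n (suc i)
      K = ℤ.+ ((n * b ^ i) / N)
      K′ = ℤ.+ ((n * b ^ suc i) / N)
      division : ∀ i → ℤ.+ (n * b ^ i) ≡ ℤ.+ coord n i ℤ.+ ℤ.+ ((n * b ^ i) / N) ℤ.* L
      division i = trans (cong ℤ.+_ (m≡m%n+[m/n]*n (n * b ^ i) N))
                         (cong (λ z → ℤ.+ coord n i ℤ.+ z) (ℤₚ.pos-* ((n * b ^ i) / N) N))
      complete : ∀ B x L K → B ℤ.* x ≡ B ℤ.* (x ℤ.+ K ℤ.* L) ℤ.- L ℤ.* (B ℤ.* K)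
      complete = ℤ-Solver.solve-∀
      collect : ∀ x K L z → x ℤ.+ K ℤ.* L ℤ.- L ℤ.* z ≡ x ℤ.+ L ℤ.* (K ℤ.- z)
      collect = ℤ-Solver.solve-∀
      shift : ∀ b n p → b * (n * p) ≡ n * (b * p)
      shift = ℕ-Solver.solve-∀

    coord-zero : ∀ {n} → n < N → coord n 0 ≡ n
    coord-zero {n} n<N = trans (cong (_% N) (ℕₚ.*-identityʳ n)) (m<n⇒m%n≡m n<N)

    coord-period : ∀ {n} → n < N → coord n d ≡ n
    coord-period {n} n<N = begin
      (n * b ^ d) % N           ≡⟨ cong (λ p → (n * p) % N) b^d ⟩
      (n * suc (2 * N)) % N     ≡⟨ cong (_% N) (expand n N) ⟩
      (n + 2 * n * N) % N       ≡⟨ [m+kn]%n≡m%n n (2 * n) N ⟩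
      n % N                     ≡⟨ m<n⇒m%n≡m n<N ⟩
      n                         ∎
      where
      open ≡-Reasoning
      expand : ∀ n L → n * suc (2 * L) ≡ n + 2 * n * L
      expand = ℕ-Solver.solve-∀

    sqDist-lower-bound : ∀ {n m} → n < N → m < N → point N (powers b d) n ≢ point N (powers b d) m →
      2 * (N * N) ≤ suc b * suc b * sqDist (point N (powers b d) n) (point N (powers b d) m)
    sqDist-lower-bound {n} {m} n<N m<N x≢y =
      subst (λ s → 2 * (N * N) ≤ suc b * suc b * s)
            (sym (sqDist-map-tabulate (λ a → (n * a) % N) (λ a → (m * a) % N) (b ^_) d))
            (CyclicSequences.sumSq-lower-bound b N δ q d b-odd b^d step δ-period δ₀≢0)
      where
      δ q : ℕ → ℤ.ℤ
      δ i = ℤ.+ coord n i ℤ.- ℤ.+ coord m i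
      q i = carry n i ℤ.- carry m i
      step : ∀ i → ℤ.+ b ℤ.* δ i ≡ δ (suc i) ℤ.+ ℤ.+ N ℤ.* q i
      step i = trans (distrib (ℤ.+ b) (ℤ.+ coord n i) (ℤ.+ coord m i))
        (trans (cong₂ ℤ._-_ (coord-step n i) (coord-step m i))
               (collect (ℤ.+ coord n (suc i)) (ℤ.+ coord m (suc i)) (ℤ.+ N) (carry n i) (carry m i)))
        where
        distrib : ∀ b x y → b ℤ.* (x ℤ.- y) ≡ b ℤ.* x ℤ.- b ℤ.* y
        distrib = ℤ-Solver.solve-∀
        collect : ∀ x y L q r → (x ℤ.+ L ℤ.* q) ℤ.- (y ℤ.+ L ℤ.* r) ≡ x ℤ.- y ℤ.+ L ℤ.* (q ℤ.- r)
        collect = ℤ-Solver.solve-∀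
      δ-period : δ d ≡ δ 0
      δ-period = cong₂ (λ x y → ℤ.+ x ℤ.- ℤ.+ y)
        (trans (coord-period n<N) (sym (coord-zero n<N)))
        (trans (coord-period m<N) (sym (coord-zero m<N)))
      -- The first generator is b^0 = 1, so the first coordinate is the index itself and already
      -- separates the points.
      δ₀≢0 : δ 0 ≢ ℤ.+ 0
      δ₀≢0 eq = x≢y (cong (point N (powers b d)) n≡m)
        where
        n≡m : n ≡ m
        n≡m = trans (sym (coord-zero n<N))
          (trans (ℤₚ.+-injective (ℤₚ.i-j≡0⇒i≡j (ℤ.+ coord n 0) (ℤ.+ coord m 0) eq)) (coord-zero m<N))

  -- An explicit point close to the origin.

  ∣0-+n∣≡n : ∀ n → ℤ.∣ ℤ.+ 0 ℤ.- ℤ.+ n ∣ ≡ n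
  ∣0-+n∣≡n n = trans (cong ℤ.∣_∣ (ℤₚ.+-identityˡ (ℤ.- (ℤ.+ n)))) (ℤₚ.∣-i∣≡∣i∣ (ℤ.+ n))

  square-halves : ∀ x y → 2 * x ≤ y → 4 * (ℤ.∣ ℤ.+ 0 ℤ.- ℤ.+ x ∣ * ℤ.∣ ℤ.+ 0 ℤ.- ℤ.+ x ∣) ≤ y * y
  square-halves x y 2x≤y = begin
    4 * (ℤ.∣ ℤ.+ 0 ℤ.- ℤ.+ x ∣ * ℤ.∣ ℤ.+ 0 ℤ.- ℤ.+ x ∣) ≡⟨ cong (λ z → 4 * (z * z)) (∣0-+n∣≡n x) ⟩
    4 * (x * x)        ≡⟨ regroup x ⟩
    2 * x * (2 * x)    ≤⟨ ℕₚ.*-mono-≤ 2x≤y 2x≤y ⟩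
    y * y              ∎
    where
    open ℕₚ.≤-Reasoning
    regroup : ∀ x → 4 * (x * x) ≡ 2 * x * (2 * x)
    regroup = ℕ-Solver.solve-∀

  -- Induction on 1 + b² C² ≤ (1 + b)² C² for C ≥ 1, with `a * b` in place of `a` for the tail.
  -- Replacing the whole geometric sum by (1 + b)^(2m) costs only lower order terms, as its last
  -- summand b^(2m) dominates.
  geometric-bound : ∀ b a m (f : ℕ → ℕ) → (∀ i → 2 * f i ≤ a * b ^ i) →
    4 * sumSq (λ i → ℤ.+ 0 ℤ.- ℤ.+ f i) (suc m) ≤ a * suc b ^ m * (a * suc b ^ m)
  geometric-bound b a zero    f f≤ = subst (λ s → 4 * s ≤ a * 1 * (a * 1))
    (sym (ℕₚ.+-identityʳ (ℤ.∣ ℤ.+ 0 ℤ.- ℤ.+ f 0 ∣ * ℤ.∣ ℤ.+ 0 ℤ.- ℤ.+ f 0 ∣)))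
    (square-halves (f 0) (a * 1) (f≤ 0))
  geometric-bound b a (suc m) f f≤ = begin
    4 * (x² + s)                                 ≡⟨ ℕₚ.*-distribˡ-+ 4 x² s ⟩
    4 * x² + 4 * s                               ≤⟨ ℕₚ.+-mono-≤ (square-halves (f 0) (a * 1) (f≤ 0))
                                                      (geometric-bound b (a * b) m (f ∘ suc) f≤′) ⟩
    a * 1 * (a * 1) + a * b * C * (a * b * C)    ≤⟨ absorb C (ℕₚ.m^n>0 (suc b) m) ⟩
    a * (suc b * C) * (a * (suc b * C))          ∎
    where
    open ℕₚ.≤-Reasoning
    x² = ℤ.∣ ℤ.+ 0 ℤ.- ℤ.+ f 0 ∣ * ℤ.∣ ℤ.+ 0 ℤ.- ℤ.+ f 0 ∣
    s = sumSq (λ i → ℤ.+ 0 ℤ.- ℤ.+ f (suc i)) (suc m)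
    C = suc b ^ m
    f≤′ : ∀ i → 2 * f (suc i) ≤ a * b * b ^ i
    f≤′ i = ℕₚ.≤-trans (f≤ (suc i)) (ℕₚ.≤-reflexive (sym (ℕₚ.*-assoc a b (b ^ i))))
    absorb : ∀ C → 0 < C → a * 1 * (a * 1) + a * b * C * (a * b * C) ≤ a * (suc b * C) * (a * (suc b * C))
    absorb (suc t) _ = ℕₚ.m+n≤o⇒m≤o _ (ℕₚ.≤-reflexive (expand a b t))
      where
      expand : ∀ a b t → a * 1 * (a * 1) + a * b * suc t * (a * b * suc t) +
                         a * a * (2 * b * suc t * suc t + t * t + 2 * t) ≡
                         a * (suc b * suc t) * (a * (suc b * suc t))
      expand = ℕ-Solver.solve-∀

  -- With d = e + 2, the point for n = (b^(d-1) + 1) / 2 is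
  -- n = (b^(d-1) + 1) / 2 followed by (1 + b) / 2 · (1 , b , … , b^(d-2)).
  module _ (b k h M e : ℕ) (b≡1+2k : b ≡ suc (2 * k)) (1<b : 1 < b)
           (b^d-1 : b ^ suc e ≡ suc (2 * h)) (b^d : b ^ suc (suc e) ≡ suc (2 * suc M)) where
    private
      N = suc M
      d = suc (suc e)
      n = suc h
      b-odd : ∃ λ k → b ≡ suc (2 * k)
      b-odd = k , b≡1+2k
      C = suc b ^ suc e

      2n : 2 * n ≡ suc (b ^ suc e)
      2n = trans (double h) (cong suc (sym b^d-1))
        where
        double : ∀ h → 2 * suc h ≡ suc (suc (2 * h))
        double = ℕ-Solver.solve-∀

      0<h : 0 < h
      0<h = positive h (subst (1 <_) b^d-1 (ℕₚ.≤-trans 1<b (subst (_≤ b ^ suc e) (ℕₚ.*-identityʳ b)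
        (ℕₚ.*-monoʳ-≤ b (ℕₚ.m^n>0 b {{ℕ.>-nonZero (ℕₚ.<-trans ℕₚ.0<1+n 1<b)}} e)))))
        where
        positive : ∀ h → 1 < suc (2 * h) → 0 < h
        positive zero    (s≤s ())
        positive (suc _) _ = s≤s z≤n

      -- An odd b > 1 is at least 3, and 3 (2h + 1) already exceeds 2n + 1 = 2h + 3.
      n<N : n < N
      n<N = ℕₚ.*-cancelˡ-< 2 n N (ℕₚ.+-cancelˡ-< 1 (2 * n) (2 * N) (begin-strict
        1 + 2 * n            ≡⟨ expand h ⟩
        3 + 2 * h            <⟨ ℕₚ.+-monoʳ-< 3 (ℕₚ.m<m+n (2 * h) {h * 4} (ℕₚ.*-monoˡ-< 4 0<h)) ⟩
        3 + (2 * h + h * 4)  ≡⟨ collect h ⟩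
        3 * suc (2 * h)      ≤⟨ ℕₚ.*-monoˡ-≤ (suc (2 * h)) (3≤ k b≡1+2k) ⟩
        b * suc (2 * h)      ≡⟨ cong (b *_) (sym b^d-1) ⟩
        b ^ d                ≡⟨ b^d ⟩
        1 + 2 * N            ∎))
        where
        open ℕₚ.≤-Reasoning
        expand : ∀ h → 1 + 2 * suc h ≡ 3 + 2 * h
        expand = ℕ-Solver.solve-∀
        collect : ∀ h → 3 + (2 * h + h * 4) ≡ 3 * suc (2 * h)
        collect = ℕ-Solver.solve-∀
        3≤ : ∀ k → b ≡ suc (2 * k) → 3 ≤ b
        3≤ zero    b≡1 = contradiction b≡1 (ℕₚ.>⇒≢ 1<b)
        3≤ (suc k) b≡  = subst (3 ≤_) (sym b≡) (s≤s (ℕₚ.*-monoʳ-≤ 2 {1} {suc k} (s≤s z≤n)))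

      x : ℕ → ℕ
      x = coord b M d b-odd b^d n

      x≢0 : point N (powers b d) 0 ≢ point N (powers b d) n
      x≢0 eq with () ← trans (cong Vec.head eq) (coord-zero b M d b-odd b^d n<N)

      -- From 2n = b^(d-1) + 1 and b^d = 2N + 1 follows n b^(i+1) = (k + 1) b^i + b^i N. A residue
      -- is at most the number itself, which gives the bound for every i at once.
      x-suc : ∀ i → 2 * x (suc i) ≤ suc b * b ^ i
      x-suc i = begin
        2 * ((n * b ^ suc i) % N)                        ≡⟨ cong (λ z → 2 * (z % N)) (ℕₚ.*-cancelˡ-≡ (n * b ^ suc i) (suc k * b ^ i + b ^ i * N) 2 doubled) ⟩
        2 * ((suc k * b ^ i + b ^ i * N) % N)      ≡⟨ cong (2 *_) ([m+kn]%n≡m%n (suc k * b ^ i) (b ^ i) N) ⟩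
        2 * ((suc k * b ^ i) % N)                  ≤⟨ ℕₚ.*-monoʳ-≤ 2 (m%n≤m (suc k * b ^ i) N) ⟩
        2 * (suc k * b ^ i)                        ≡⟨ trans (regroup k (b ^ i)) (cong (λ z → suc z * b ^ i) (sym b≡1+2k)) ⟩
        suc b * b ^ i                                    ∎
        where
        open ℕₚ.≤-Reasoning
        regroup : ∀ k p → 2 * (suc k * p) ≡ suc (suc (2 * k)) * p
        regroup = ℕ-Solver.solve-∀
        expand : ∀ n b p → 2 * (n * (b * p)) ≡ 2 * n * b * p
        expand = ℕ-Solver.solve-∀
        shift : ∀ b q p → suc q * b * p ≡ (b + b * q) * p
        shift = ℕ-Solver.solve-∀
        collect : ∀ k p N → (suc (2 * k) + suc (2 * N)) * p ≡ 2 * (suc k * p + p * N)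
        collect = ℕ-Solver.solve-∀
        doubled : 2 * (n * b ^ suc i) ≡ 2 * (suc k * b ^ i + b ^ i * N)
        doubled = trans (expand n b (b ^ i)) (trans (cong (λ z → z * b * b ^ i) 2n)
          (trans (shift b (b ^ suc e) (b ^ i)) (trans (cong₂ (λ y z → (y + z) * b ^ i) b≡1+2k b^d) (collect k (b ^ i) N))))

      sqDist≡ : sqDist (point N (powers b d) 0) (point N (powers b d) n) ≡
                sumSq (λ i → ℤ.+ 0 ℤ.- ℤ.+ x i) d
      sqDist≡ = sqDist-map-tabulate (λ _ → 0) (λ a → (n * a) % N) (b ^_) d

      -- The first coordinate and all the others together contribute at most C² / 4 each.
      sqDist-bound : 2 * sqDist (point N (powers b d) 0) (point N (powers b d) n) ≤ C * C
      sqDist-bound = subst (λ s → 2 * s ≤ C * C) (sym sqDist≡)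
        (halves {sq₀} {sumSq (λ i → ℤ.+ 0 ℤ.- ℤ.+ x (suc i)) (suc e)} {C * C} (square-halves (x 0) C first) (geometric-bound b (suc b) e (x ∘ suc) x-suc))
        where
        sq₀ = ℤ.∣ ℤ.+ 0 ℤ.- ℤ.+ x 0 ∣ * ℤ.∣ ℤ.+ 0 ℤ.- ℤ.+ x 0 ∣
        halves : ∀ {y z w} → 4 * y ≤ w → 4 * z ≤ w → 2 * (y + z) ≤ w
        halves {y} {z} {w} 4y≤w 4z≤w = ℕₚ.*-cancelˡ-≤ 2 (begin
          2 * (2 * (y + z))   ≡⟨ split y z ⟩
          4 * y + 4 * z       ≤⟨ ℕₚ.+-mono-≤ 4y≤w 4z≤w ⟩
          w + w               ≡⟨ double w ⟩
          2 * w               ∎)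
          where
          open ℕₚ.≤-Reasoning
          split : ∀ x y → 2 * (2 * (x + y)) ≡ 4 * x + 4 * y
          split = ℕ-Solver.solve-∀
          double : ∀ x → x + x ≡ 2 * x
          double = ℕ-Solver.solve-∀
        open ℕₚ.≤-Reasoning
        first : 2 * x 0 ≤ C
        first = begin
          2 * x 0          ≡⟨ cong (2 *_) (coord-zero b M d b-odd b^d n<N) ⟩
          2 * n            ≡⟨ 2n ⟩
          -- The relation `_<_` unfolds to `suc _ ≤ _`, so strict monotonicity absorbs the summand
          -- 1.
          suc (b ^ suc e)  ≤⟨ ℕₚ.^-monoˡ-< (suc e) (ℕₚ.n<1+n b) ⟩
          C                ∎

    lambdaSq-upper-bound : 2 * lambdaSq N (powers b d) ≤ C * C
    lambdaSq-upper-bound = ℕₚ.≤-trans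
      (ℕₚ.*-monoʳ-≤ 2 (lambdaSq-≤ N (powers b d) (s≤s z≤n) n<N x≢0)) sqDist-bound

    lambdaSq-lower-bound : 2 * (N * N) ≤ suc b * suc b * lambdaSq N (powers b d)
    lambdaSq-lower-bound = lambdaSq-elim N (powers b d) (λ s → 2 * (N * N) ≤ suc b * suc b * s)
      (λ _ _ → sqDist-lower-bound b M d b-odd b^d) {n = 0} {m = n} (s≤s z≤n) n<N x≢0

-- Turning both bounds into a relative error of order 1/b.

module Asymptotics where
  open import Data.Nat using (_+_; _*_; NonZero; ∣_-_∣)
  open ℕₚ.≤-Reasoning

  ^-distribʳ-* : ∀ x y n → (x * y) ^ n ≡ x ^ n * y ^ n
  ^-distribʳ-* x y zero    = refl
  ^-distribʳ-* x y (suc n) = trans (cong (x * y *_) (^-distribʳ-* x y n)) (swap x y (x ^ n) (y ^ n))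
    where
    swap : ∀ x y u v → x * y * (u * v) ≡ x * u * (y * v)
    swap = ℕ-Solver.solve-∀

  -- Bernoulli's inequality (1 - D/c)ʲ ≥ 1 - jD/c for y/z ≥ 1 - D/c, without subtraction.
  bernoulli : ∀ {y z c D} → y ≤ z → z * c ≤ y * c + D * z → ∀ j → z ^ j * c ≤ y ^ j * c + j * D * z ^ j
  bernoulli {y} {z} {c} {D} y≤z zc≤ zero    = ℕₚ.m≤m+n (1 * c) _
  bernoulli {y} {z} {c} {D} y≤z zc≤ (suc j) = begin
    z * z ^ j * c                                     ≡⟨ ℕₚ.*-assoc z (z ^ j) c ⟩
    z * (z ^ j * c)                                   ≤⟨ ℕₚ.*-monoʳ-≤ z (bernoulli y≤z zc≤ j) ⟩
    z * (y ^ j * c + j * D * z ^ j)                   ≡⟨ expand z (y ^ j) c (j * D) (z ^ j) ⟩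
    y ^ j * (z * c) + j * D * (z * z ^ j)             ≤⟨ ℕₚ.+-monoˡ-≤ _ (ℕₚ.*-monoʳ-≤ (y ^ j) zc≤) ⟩
    y ^ j * (y * c + D * z) + j * D * (z * z ^ j)     ≡⟨ collect y (y ^ j) c D z (j * D * (z * z ^ j)) ⟩
    y * y ^ j * c + D * (z * y ^ j) + j * D * (z * z ^ j)
      ≤⟨ ℕₚ.+-monoˡ-≤ _ (ℕₚ.+-monoʳ-≤ (y * y ^ j * c) (ℕₚ.*-monoʳ-≤ D (ℕₚ.*-monoʳ-≤ z (ℕₚ.^-monoˡ-≤ j y≤z)))) ⟩
    y * y ^ j * c + D * (z * z ^ j) + j * D * (z * z ^ j) ≡⟨ factor (y * y ^ j * c) D (z * z ^ j) j ⟩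
    y * y ^ j * c + suc j * D * (z * z ^ j)           ∎
    where
    expand : ∀ z p c q r → z * (p * c + q * r) ≡ p * (z * c) + q * (z * r)
    expand = ℕ-Solver.solve-∀
    collect : ∀ y p c D z r → p * (y * c + D * z) + r ≡ y * p * c + D * (z * p) + r
    collect = ℕ-Solver.solve-∀
    factor : ∀ x D z j → x + D * z + j * D * z ≡ x + suc j * D * z
    factor = ℕ-Solver.solve-∀

  ∣m-n∣≤o : ∀ {m n o} → m ≤ n + o → n ≤ m + o → ∣ m - n ∣ ≤ o
  ∣m-n∣≤o {m} {n} {o} m≤ n≤ with ℕₚ.∣m-n∣≡[m∸n]∨[n∸m] m n
  ... | inj₁ eq = subst (_≤ o) (sym eq) (ℕₚ.m≤n+o⇒m∸n≤o m n m≤)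
  ... | inj₂ eq = subst (_≤ o) (sym eq) (ℕₚ.m≤n+o⇒m∸n≤o n m n≤)

  -- The point set enters only through lower and upper, both of which compare S with c^(2d-2) / 2 since
  -- 2N ≈ c^d. In the theorem p = s + u and q = 2s + u, so that S^p ≈ 2^s N^q.
  module Squeeze (b N S d′ s u : ℕ) .{{_ : NonZero N}}
                 (b^d : b ^ suc d′ ≡ suc (2 * N))
                 (lower : 2 * (N * N) ≤ suc b * suc b * S)
                 (upper : 2 * S ≤ suc b ^ d′ * suc b ^ d′)
                 (du≡2p : suc d′ * u ≡ 2 * (s + u))
                 (2[d-1]p≡dq : d′ * 2 * (s + u) ≡ suc d′ * (2 * s + u)) where
    private
      p = s + u
      q = 2 * s + u
      d = suc d′
      D = suc d
      E = q * D
      c = suc b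
      Z = (c ^ d) ^ q
      U = (c ^ d) ^ u
      A = (2 * S) ^ p
      W = (2 * N) ^ q
      V = (2 * N) ^ u

      instance
        U≢0 : NonZero U
        U≢0 = ℕₚ.m^n≢0 (c ^ d) u {{ℕₚ.m^n≢0 c d}}

      2N≤c^d : 2 * N ≤ c ^ d
      2N≤c^d = begin
        2 * N        ≤⟨ ℕₚ.n≤1+n (2 * N) ⟩
        suc (2 * N)  ≡⟨ sym b^d ⟩
        b ^ d        ≤⟨ ℕₚ.^-monoˡ-≤ d (ℕₚ.n≤1+n b) ⟩
        c ^ d        ∎

      -- This says 2N / c^d ≥ 1 - (d + 1)/c. Bernoulli for b/c = 1 - 1/c loses d/c; the 1 in b^d =
      -- 2N + 1 loses one further 1/c, hence `D = suc d`.
      c^d-bernoulli : c ^ d * c ≤ 2 * N * c + D * c ^ d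
      c^d-bernoulli = begin
        c ^ d * c                       ≤⟨ bernoulli {b} {c} {c} {1} (ℕₚ.n≤1+n b) (ℕₚ.≤-reflexive (base b)) d ⟩
        b ^ d * c + d * 1 * c ^ d       ≡⟨ cong (λ x → x * c + d * 1 * c ^ d) b^d ⟩
        suc (2 * N) * c + d * 1 * c ^ d ≡⟨ expand (2 * N) c d (c ^ d) ⟩
        2 * N * c + (c + d * c ^ d)     ≤⟨ ℕₚ.+-monoʳ-≤ (2 * N * c) (ℕₚ.+-monoˡ-≤ (d * c ^ d) c≤c^d) ⟩
        2 * N * c + D * c ^ d           ∎
        where
        base : ∀ b → suc b * suc b ≡ b * suc b + 1 * suc b
        base = ℕ-Solver.solve-∀
        expand : ∀ M c d x → suc M * c + d * 1 * x ≡ M * c + (c + d * x)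
        expand = ℕ-Solver.solve-∀
        c≤c^d : c ≤ c ^ d
        c≤c^d = subst (_≤ c ^ d) (ℕₚ.*-identityʳ c) (ℕₚ.*-monoʳ-≤ c (ℕₚ.m^n>0 c d′))

      A≤Z : A ≤ Z
      A≤Z = begin
        (2 * S) ^ p               ≤⟨ ℕₚ.^-monoˡ-≤ p upper ⟩
        (c ^ d′ * c ^ d′) ^ p     ≡⟨ cong (λ x → (c ^ d′ * x) ^ p) (sym (ℕₚ.*-identityʳ (c ^ d′))) ⟩
        ((c ^ d′) ^ 2) ^ p        ≡⟨ cong (_^ p) (ℕₚ.^-*-assoc c d′ 2) ⟩
        (c ^ (d′ * 2)) ^ p        ≡⟨ ℕₚ.^-*-assoc c (d′ * 2) p ⟩
        c ^ (d′ * 2 * p)          ≡⟨ cong (c ^_) 2[d-1]p≡dq ⟩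
        c ^ (d * q)               ≡⟨ sym (ℕₚ.^-*-assoc c d q) ⟩
        (c ^ d) ^ q               ∎

      -- The p-th power of (2N)² ≤ c² (2S). As 2p = q + u on the left and 2p = d u in the exponent
      -- of c, the surplus factors are (2N)^u and (c^d)^u, whose ratio tends to 1.
      W*V≤U*A : W * V ≤ U * A
      W*V≤U*A = begin
        (2 * N) ^ q * (2 * N) ^ u     ≡⟨ sym (ℕₚ.^-distribˡ-+-* (2 * N) q u) ⟩
        (2 * N) ^ (q + u)             ≡⟨ cong ((2 * N) ^_) (q+u≡2p s u) ⟩
        (2 * N) ^ (2 * p)             ≡⟨ sym (ℕₚ.^-*-assoc (2 * N) 2 p) ⟩
        ((2 * N) ^ 2) ^ p             ≤⟨ ℕₚ.^-monoˡ-≤ p squared ⟩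
        (c ^ 2 * (2 * S)) ^ p         ≡⟨ ^-distribʳ-* (c ^ 2) (2 * S) p ⟩
        (c ^ 2) ^ p * A               ≡⟨ cong (_* A) (ℕₚ.^-*-assoc c 2 p) ⟩
        c ^ (2 * p) * A               ≡⟨ cong (λ x → c ^ x * A) (sym du≡2p) ⟩
        c ^ (d * u) * A               ≡⟨ cong (_* A) (sym (ℕₚ.^-*-assoc c d u)) ⟩
        U * A                         ∎
        where
        q+u≡2p : ∀ s u → 2 * s + u + u ≡ 2 * (s + u)
        q+u≡2p = ℕ-Solver.solve-∀
        left : ∀ N → 2 * N * (2 * N * 1) ≡ 2 * (2 * (N * N))
        left = ℕ-Solver.solve-∀
        right : ∀ c S → 2 * (c * c * S) ≡ c * (c * 1) * (2 * S)
        right = ℕ-Solver.solve-∀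
        squared : (2 * N) ^ 2 ≤ c ^ 2 * (2 * S)
        squared = begin
          (2 * N) ^ 2          ≡⟨ left N ⟩
          2 * (2 * (N * N))    ≤⟨ ℕₚ.*-monoʳ-≤ 2 lower ⟩
          2 * (c * c * S)      ≡⟨ right c S ⟩
          c ^ 2 * (2 * S)      ∎

      W*c≤ : W * c ≤ A * c + u * D * W
      W*c≤ = ℕₚ.*-cancelˡ-≤ U (begin
        U * (W * c)                     ≡⟨ swap U W c ⟩
        W * (U * c)                     ≤⟨ ℕₚ.*-monoʳ-≤ W (bernoulli 2N≤c^d c^d-bernoulli u) ⟩
        W * (V * c + u * D * U)         ≡⟨ expand W V c (u * D) U ⟩
        W * V * c + u * D * W * U       ≤⟨ ℕₚ.+-monoˡ-≤ _ (ℕₚ.*-monoˡ-≤ c W*V≤U*A) ⟩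
        U * A * c + u * D * W * U       ≡⟨ collect U A c (u * D * W) ⟩
        U * (A * c + u * D * W)         ∎)
        where
        swap : ∀ x y z → x * (y * z) ≡ y * (x * z)
        swap = ℕ-Solver.solve-∀
        expand : ∀ w v c e x → w * (v * c + e * x) ≡ w * v * c + e * w * x
        expand = ℕ-Solver.solve-∀
        collect : ∀ x a c e → x * a * c + e * x ≡ x * (a * c + e)
        collect = ℕ-Solver.solve-∀

      Z*c≤ : Z * c ≤ W * c + E * Z
      Z*c≤ = bernoulli 2N≤c^d c^d-bernoulli q

      -- Once the relative error E/c is at most 1/2, it can be measured against `W`, a multiple of
      -- N^q, in place of `Z`.
      Z≤2W : 2 * E ≤ c → Z ≤ 2 * W
      Z≤2W 2E≤c = ℕₚ.*-cancelʳ-≤ Z (2 * W) c (ℕₚ.+-cancelʳ-≤ (Z * c) (Z * c) (2 * W * c) (begin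
        Z * c + Z * c          ≤⟨ ℕₚ.+-mono-≤ Z*c≤ Z*c≤ ⟩
        W * c + E * Z + (W * c + E * Z) ≡⟨ regroup W c E Z ⟩
        2 * W * c + Z * (2 * E) ≤⟨ ℕₚ.+-monoʳ-≤ (2 * W * c) (ℕₚ.*-monoʳ-≤ Z 2E≤c) ⟩
        2 * W * c + Z * c      ∎))
        where
        regroup : ∀ w c e z → w * c + e * z + (w * c + e * z) ≡ 2 * w * c + z * (2 * e)
        regroup = ℕ-Solver.solve-∀

      A*c≤ : 2 * E ≤ c → A * c ≤ W * c + 2 * E * W
      A*c≤ 2E≤c = begin
        A * c               ≤⟨ ℕₚ.*-monoˡ-≤ c A≤Z ⟩
        Z * c               ≤⟨ Z*c≤ ⟩
        W * c + E * Z       ≤⟨ ℕₚ.+-monoʳ-≤ (W * c) (ℕₚ.*-monoʳ-≤ E (Z≤2W 2E≤c)) ⟩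
        W * c + E * (2 * W) ≡⟨ cong (W * c +_) (swap E W) ⟩
        W * c + 2 * E * W   ∎
        where
        swap : ∀ e w → e * (2 * w) ≡ 2 * e * w
        swap = ℕ-Solver.solve-∀

      uD≤2E : u * D ≤ 2 * E
      uD≤2E = begin
        u * D        ≤⟨ ℕₚ.*-monoˡ-≤ D (ℕₚ.m≤n+m u (2 * s)) ⟩
        E            ≤⟨ ℕₚ.m≤m+n E (1 * E) ⟩
        2 * E        ∎

      W≡ : W ≡ 2 ^ p * (2 ^ s * N ^ q)
      W≡ = begin-equality
        (2 * N) ^ q                  ≡⟨ ^-distribʳ-* 2 N q ⟩
        2 ^ q * N ^ q                ≡⟨ cong (λ x → 2 ^ x * N ^ q) (q≡p+s s u) ⟩
        2 ^ (p + s) * N ^ q          ≡⟨ cong (_* N ^ q) (ℕₚ.^-distribˡ-+-* 2 p s) ⟩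
        2 ^ p * 2 ^ s * N ^ q        ≡⟨ ℕₚ.*-assoc (2 ^ p) (2 ^ s) (N ^ q) ⟩
        2 ^ p * (2 ^ s * N ^ q)      ∎
        where
        q≡p+s : ∀ s u → 2 * s + u ≡ s + u + s
        q≡p+s = ℕ-Solver.solve-∀

    -- Since q = p + s, the factor 2^p is common to `A` = (2S)^p and `W` = (2N)^q and cancels,
    -- leaving S^p against 2^s N^q.
    squeeze : 2 * E ≤ c → c * ∣ S ^ p - 2 ^ s * N ^ q ∣ ≤ 2 * E * 2 ^ s * N ^ q
    squeeze 2E≤c = ℕₚ.*-cancelˡ-≤ (2 ^ p) {{ℕₚ.m^n≢0 2 p}} (begin
      2 ^ p * (c * ∣ X - Y ∣)                  ≡⟨ swap (2 ^ p) c ∣ X - Y ∣ ⟩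
      2 ^ p * ∣ X - Y ∣ * c                    ≡⟨ cong (_* c) (ℕₚ.*-distribˡ-∣-∣ (2 ^ p) X Y) ⟩
      ∣ 2 ^ p * X - 2 ^ p * Y ∣ * c            ≡⟨ cong₂ (λ x y → ∣ x - y ∣ * c) (sym (^-distribʳ-* 2 S p)) (sym W≡) ⟩
      ∣ A - W ∣ * c                            ≡⟨ ℕₚ.*-distribʳ-∣-∣ c A W ⟩
      ∣ A * c - W * c ∣                        ≤⟨ ∣m-n∣≤o (A*c≤ 2E≤c) (ℕₚ.≤-trans W*c≤
                                                    (ℕₚ.+-monoʳ-≤ (A * c) (ℕₚ.*-monoˡ-≤ W uD≤2E))) ⟩
      2 * E * W                                ≡⟨ cong (2 * E *_) W≡ ⟩
      2 * E * (2 ^ p * (2 ^ s * N ^ q))        ≡⟨ regroup (2 * E) (2 ^ p) (2 ^ s) (N ^ q) ⟩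
      2 ^ p * (2 * E * 2 ^ s * N ^ q)          ∎)
      where
      X = S ^ p
      Y = 2 ^ s * N ^ q
      swap : ∀ x c y → x * (c * y) ≡ x * y * c
      swap = ℕ-Solver.solve-∀
      regroup : ∀ e x y z → e * (x * (y * z)) ≡ x * (e * y * z)
      regroup = ℕ-Solver.solve-∀

-- Rational ε-estimates and the two limits.

module Limits where
  open import Data.Nat using (_+_; _*_; _∸_; _<_; NonZero; ∣_-_∣)
  open PointSets
  open Asymptotics using (module Squeeze)

  -- Unnormalised fractions spare the gcd computations of `ℚ`. The final 0 in `mkℚᵘ` is the
  -- denominator minus one.
  toℚᵘ-∣-∣ : ∀ x y → ℚ.toℚᵘ ℚ.∣ ℕ→ℚ x ℚ.- ℕ→ℚ y ∣ ℚᵘ.≃ ℚᵘ.mkℚᵘ (ℤ.+ ∣ x - y ∣) 0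
  toℚᵘ-∣-∣ x y = begin
    ℚ.toℚᵘ ℚ.∣ ℕ→ℚ x ℚ.- ℕ→ℚ y ∣           ≈⟨ ℚₚ.toℚᵘ-homo-∣-∣ (ℕ→ℚ x ℚ.- ℕ→ℚ y) ⟩
    ℚᵘ.∣ ℚ.toℚᵘ (ℕ→ℚ x ℚ.- ℕ→ℚ y) ∣        ≈⟨ ℚᵘₚ.∣-∣-cong difference ⟩
    ℚᵘ.∣ ℚᵘ.mkℚᵘ (ℤ.+ x) 0 ℚᵘ.- ℚᵘ.mkℚᵘ (ℤ.+ y) 0 ∣
      ≡⟨ cong (λ z → ℚᵘ.mkℚᵘ (ℤ.+ z) 0) (trans
           (cong₂ (λ a b → ℤ.∣ a ℤ.+ b ∣) (ℤₚ.*-identityʳ (ℤ.+ x)) (ℤₚ.*-identityʳ (ℤ.- (ℤ.+ y))))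
           (∣+m-+n∣≡∣m-n∣ x y)) ⟩
    ℚᵘ.mkℚᵘ (ℤ.+ ∣ x - y ∣) 0              ∎
    where
    open SetoidReasoning ℚᵘₚ.≃-setoid
    difference : ℚ.toℚᵘ (ℕ→ℚ x ℚ.- ℕ→ℚ y) ℚᵘ.≃ ℚᵘ.mkℚᵘ (ℤ.+ x) 0 ℚᵘ.- ℚᵘ.mkℚᵘ (ℤ.+ y) 0
    difference = ℚᵘₚ.≃-trans (ℚₚ.toℚᵘ-homo-+ (ℕ→ℚ x) (ℚ.- ℕ→ℚ y)) (ℚᵘₚ.+-cong
      (ℚₚ.toℚᵘ-fromℚᵘ (ℚᵘ.mkℚᵘ (ℤ.+ x) 0))
      (ℚᵘₚ.≃-trans (ℚₚ.toℚᵘ-homo‿- (ℕ→ℚ y)) (ℚᵘₚ.-‿cong (ℚₚ.toℚᵘ-fromℚᵘ (ℚᵘ.mkℚᵘ (ℤ.+ y) 0)))))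

  -- A positive ε has numerator at least 1, so it is at least the reciprocal of its denominator, and
  -- R/c below that reciprocal is enough.
  relative-error-< : ∀ ε → ℚ.Positive ε → ∀ {c R} x y z .{{_ : NonZero z}} →
    c * ∣ x - y ∣ ≤ R * z → R * ℚ.↧ₙ ε < c → ℚ.∣ ℕ→ℚ x ℚ.- ℕ→ℚ y ∣ ℚ.< ε ℚ.* ℕ→ℚ z
  relative-error-< ε@(ℚ.mkℚ (ℤ.+ suc n) d _) _ {c} {R} x y z bound R*den<c =
    ℚₚ.toℚᵘ-cancel-< (ℚᵘₚ.<-respˡ-≃ (ℚᵘₚ.≃-sym (toℚᵘ-∣-∣ x y))
      (ℚᵘₚ.<-respʳ-≃ (ℚᵘₚ.≃-sym product) (ℚᵘ.*<* (subst₂ ℤ._<_ lhs rhs (ℤ.+<+ δ*den<num*z)))))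
    where
    open ℕₚ.≤-Reasoning
    δ = ∣ x - y ∣
    product : ℚ.toℚᵘ (ε ℚ.* ℕ→ℚ z) ℚᵘ.≃ ℚᵘ.mkℚᵘ (ℤ.+ suc n) d ℚᵘ.* ℚᵘ.mkℚᵘ (ℤ.+ z) 0
    product = ℚᵘₚ.≃-trans (ℚₚ.toℚᵘ-homo-* ε (ℕ→ℚ z))
      (ℚᵘₚ.*-congˡ {ℚ.toℚᵘ ε} (ℚₚ.toℚᵘ-fromℚᵘ (ℚᵘ.mkℚᵘ (ℤ.+ z) 0)))
    δ*den<num*z : δ * suc d < suc n * z
    δ*den<num*z = ℕₚ.*-cancelˡ-< c _ _ (begin-strict
      c * (δ * suc d)     ≡⟨ sym (ℕₚ.*-assoc c δ (suc d)) ⟩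
      c * δ * suc d       ≤⟨ ℕₚ.*-monoˡ-≤ (suc d) bound ⟩
      R * z * suc d       ≡⟨ swap R z (suc d) ⟩
      R * suc d * z       <⟨ ℕₚ.*-monoˡ-< z R*den<c ⟩
      c * z               ≤⟨ ℕₚ.*-monoʳ-≤ c (ℕₚ.m≤m+n z (n * z)) ⟩
      c * (suc n * z)     ∎)
      where
      swap : ∀ x y z → x * y * z ≡ x * z * y
      swap = ℕ-Solver.solve-∀
    lhs : ℤ.+ (δ * suc d) ≡ ℤ.+ δ ℤ.* ℤ.+ (suc d * 1)
    lhs = trans (cong (λ e → ℤ.+ (δ * e)) (sym (ℕₚ.*-identityʳ (suc d)))) (ℤₚ.pos-* δ (suc d * 1))
    rhs : ℤ.+ (suc n * z) ≡ ℤ.+ suc n ℤ.* ℤ.+ z ℤ.* ℤ.+ 1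
    rhs = trans (ℤₚ.pos-* (suc n) z) (sym (ℤₚ.*-identityʳ (ℤ.+ suc n ℤ.* ℤ.+ z)))

  half : ∀ {m} → (∃ λ h → m ≡ suc (2 * h)) → m ≡ suc (2 * ((m ∸ 1) / 2))
  half (h , refl) = cong (λ x → suc (2 * x)) (sym (trans (cong (_/ 2) (ℕₚ.*-comm 2 h)) (m*n/n≡m h 2)))

  bOf≡1+2k : ∀ k → bOf k ≡ suc (2 * k)
  bOf≡1+2k k = ℕₚ.+-comm (2 * k) 1

  lambdaSq-bounds : ∀ k e N → 1 ≤ k → let b = bOf k; d = suc (suc e) in b ^ d ≡ suc (2 * N) →
    NonZero N × 2 * (N * N) ≤ suc b * suc b * lambdaSq N (powers b d) ×
    2 * lambdaSq N (powers b d) ≤ suc b ^ suc e * suc b ^ suc e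
  lambdaSq-bounds k e N 1≤k b^d = by-cases N b^d
    where
    b = bOf k
    1<b : 1 < b
    1<b = subst (1 <_) (sym (bOf≡1+2k k)) (s≤s (ℕₚ.≤-trans 1≤k (ℕₚ.m≤m+n k _)))
    b^d-1 = CyclicSequences.odd-^ (k , bOf≡1+2k k) (suc e)
    -- `N` is split because the bounds are stated for `suc M`; N = 0 would give b^d = 1, impossible
    -- for b > 1.
    by-cases : ∀ N → b ^ suc (suc e) ≡ suc (2 * N) →
      NonZero N × 2 * (N * N) ≤ suc b * suc b * lambdaSq N (powers b (suc (suc e))) ×
      2 * lambdaSq N (powers b (suc (suc e))) ≤ suc b ^ suc e * suc b ^ suc e
    by-cases zero    eq with ℕₚ.m^n≡1⇒n≡0∨m≡1 b (suc (suc e)) eq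
    ... | inj₂ b≡1 = contradiction b≡1 (ℕₚ.>⇒≢ 1<b)
    by-cases (suc M) eq =
      _ , lambdaSq-lower-bound b k (proj₁ b^d-1) M e (bOf≡1+2k k) 1<b (proj₂ b^d-1) eq
        , lambdaSq-upper-bound b k (proj₁ b^d-1) M e (bOf≡1+2k k) 1<b (proj₂ b^d-1) eq

  limit : ∀ e s u → suc (suc e) * u ≡ 2 * (s + u) → suc e * 2 * (s + u) ≡ suc (suc e) * (2 * s + u) →
    (N : ℕ → ℕ) (v : ℕ → Vec ℕ (suc (suc e))) →
    (∀ k → N k ≡ (bOf k ^ suc (suc e) ∸ 1) / 2) → (∀ k → v k ≡ powers (bOf k) (suc (suc e))) →
    (ε : ℚ.ℚ) → ℚ.Positive ε → ∃ λ K → (k : ℕ) → 1 ≤ k → K ≤ k →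
    ℚ.∣ ℕ→ℚ (lambdaSq (N k) (v k) ^ (s + u)) ℚ.- ℕ→ℚ (2 ^ s * N k ^ (2 * s + u)) ∣
      ℚ.< ε ℚ.* ℕ→ℚ (N k ^ (2 * s + u))
  -- The first summand of the threshold yields the accuracy ε, the second the condition `2 * E ≤ c`;
  -- both use c = 2k + 2 > k.
  limit e s u du≡2p 2[d-1]p≡dq N v N≡ v≡ ε ε>0 = R * ℚ.↧ₙ ε + 2 * E , below
    where
    d = suc (suc e)
    E = (2 * s + u) * suc d
    R = 2 * E * 2 ^ s
    below : ∀ k → 1 ≤ k → R * ℚ.↧ₙ ε + 2 * E ≤ k →
      ℚ.∣ ℕ→ℚ (lambdaSq (N k) (v k) ^ (s + u)) ℚ.- ℕ→ℚ (2 ^ s * N k ^ (2 * s + u)) ∣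
        ℚ.< ε ℚ.* ℕ→ℚ (N k ^ (2 * s + u))
    below k 1≤k K≤k =
      relative-error-< ε ε>0 {suc (bOf k)} {R} (lambdaSq (N k) (v k) ^ (s + u)) (2 ^ s * N k ^ (2 * s + u))
        (N k ^ (2 * s + u)) {{ℕₚ.m^n≢0 (N k) (2 * s + u) {{proj₁ bounds}}}}
        (Squeeze.squeeze (bOf k) (N k) (lambdaSq (N k) (v k)) (suc e) s u {{proj₁ bounds}} b^d
          (proj₁ (proj₂ bounds)) (proj₂ (proj₂ bounds)) du≡2p 2[d-1]p≡dq
          (ℕₚ.<⇒≤ (ℕₚ.≤-<-trans (ℕₚ.m+n≤o⇒n≤o (R * ℚ.↧ₙ ε) K≤k) k<c)))
        (ℕₚ.≤-<-trans (ℕₚ.m+n≤o⇒m≤o (R * ℚ.↧ₙ ε) K≤k) k<c)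
      where
      b^d : bOf k ^ d ≡ suc (2 * N k)
      b^d = trans (half (CyclicSequences.odd-^ (k , bOf≡1+2k k) d)) (cong (λ x → suc (2 * x)) (sym (N≡ k)))
      bounds : NonZero (N k) × 2 * (N k * N k) ≤ suc (bOf k) * suc (bOf k) * lambdaSq (N k) (v k) ×
               2 * lambdaSq (N k) (v k) ≤ suc (bOf k) ^ suc e * suc (bOf k) ^ suc e
      bounds = subst (λ w → NonZero (N k) × 2 * (N k * N k) ≤ suc (bOf k) * suc (bOf k) * lambdaSq (N k) w ×
                            2 * lambdaSq (N k) w ≤ suc (bOf k) ^ suc e * suc (bOf k) ^ suc e)
                     (sym (v≡ k)) (lambdaSq-bounds k e (N k) 1≤k b^d)
      k<c : k < suc (bOf k)
      k<c = s≤s (ℕₚ.≤-trans (ℕₚ.m≤m+n k (1 * k)) (ℕₚ.m≤m+n (2 * k) 1))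

  -- Only the second entry needs an argument: b^1 computes to b * 1.
  v4≡powers : ∀ k → v4 k ≡ powers (bOf k) 4
  v4≡powers k = cong (λ b → 1 ∷ b ∷ bOf k ^ 2 ∷ bOf k ^ 3 ∷ []) (sym (ℕₚ.*-identityʳ (bOf k)))

  v5≡powers : ∀ k → v5 k ≡ powers (bOf k) 5
  v5≡powers k = cong (λ b → 1 ∷ b ∷ bOf k ^ 2 ∷ bOf k ^ 3 ∷ bOf k ^ 4 ∷ []) (sym (ℕₚ.*-identityʳ (bOf k)))

open import Data.Rational using (ℚ; _<_; _*_; _-_; ∣_∣; Positive)

theorem4 : ((ε : ℚ) → Positive ε → ∃ λ K → (k : ℕ) → 1 ≤ k → K ≤ k →
    ∣ ℕ→ℚ (lambdaSq (N4 k) (v4 k) ^ 2) - ℕ→ℚ (2 Data.Nat.* N4 k ^ 3) ∣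
    < ε * ℕ→ℚ (N4 k ^ 3))
    ×
    ((ε : ℚ) → Positive ε → ∃ λ K → (k : ℕ) → 1 ≤ k → K ≤ k →
    ∣ ℕ→ℚ (lambdaSq (N5 k) (v5 k) ^ 5) - ℕ→ℚ (8 Data.Nat.* N5 k ^ 8) ∣
    < ε * ℕ→ℚ (N5 k ^ 8))
-- The smallest positive solutions of d u = 2 (s + u): for d = 4, s = u = 1 gives p = 2 and q = 3;
-- for d = 5, s = 3 and u = 2 give p = 5 and q = 8. The limit of λ* / N^(q/(2p)) is then 2^(s/(2p)).
theorem4 = Limits.limit 2 1 1 refl refl N4 v4 (λ _ → refl) Limits.v4≡powers
         , Limits.limit 3 3 2 refl refl N5 v5 (λ _ → refl) Limits.v5≡powers
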